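{- $\overline{\alpha}(K_n) = O(\log n)$; that is, there is a constant $C$ such that for all $n\ge 2$ there exist a straight-line drawing $\widetilde K_n$ of $K_n$ and an edge-ordering of it in which every non-crossing monotone path has length at most $C\log n$.
   Context: A geometric graph is a graph whose vertices are points in the plane in general position and whose edges are straight line segments joining these points; a straight-line drawing of a graph $G$ is a geometric graph isomorphic to $G$. An edge-ordering is a total order on the edges. In an edge-ordered graph, a path $v_1v_2\ldots v_k$ is increasing if $(v_iv_{i+1}) > (v_{i+1}v_{i+2})$ for all $i=1,\ldots,k-2$, decreasing if $(v_iv_{i+1}) < (v_{i+1}v_{i+2})$ for all $i$, and monotone if it is increasing or decreasing. Its length is its number of edges. A path in a geometric graph is non-crossing if no two of its edges cross. For a geometric graph $\widetilde G$, $\overline\alpha(\widetilde G)$ is the minimum, over all edge-orderings of $\widetilde G$, of the maximum length of a non-crossing monotone path in $\widetilde G$; $\overline\alpha(G)$ is the minimum of $\overline\alpha(\widetilde G)$ over all straight-line drawings $\widetilde G$ of $G$. -}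

module Defs where

open import Data.Nat as ℕ using (ℕ)
open import Data.Integer as ℤ using (ℤ; 0ℤ)
open import Data.Fin using (Fin)
open import Data.Product using (_×_; _,_)
open import Data.Sum using (_⊎_)
open import Data.Unit using (⊤)
open import Data.List using (List; []; _∷_)
open import Data.List.Membership.Propositional using (_∈_)
open import Relation.Binary.PropositionalEquality using (_≡_; _≢_)
open import Relation.Nullary using (¬_)

-- Points of the plane (integer coordinates; see NOTES.md).
Point : Set
Point = ℤ × ℤ

-- Orientation determinant of an ordered triple of points.
orient : Point → Point → Point → ℤ
orient (x₁ , y₁) (x₂ , y₂) (x₃ , y₃) =
  ((x₂ ℤ.- x₁) ℤ.* (y₃ ℤ.- y₁)) ℤ.- ((y₂ ℤ.- y₁) ℤ.* (x₃ ℤ.- x₁))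

-- A straight-line drawing of K_n: an injective placement of the n vertices
-- in general position (no three distinct vertices collinear).
IsDrawing : (n : ℕ) → (Fin n → Point) → Set
IsDrawing n p =
  (∀ i j → p i ≡ p j → i ≡ j) ×
  (∀ i j k → i ≢ j → j ≢ k → i ≢ k → orient (p i) (p j) (p k) ≢ 0ℤ)

-- An edge-ordering of K_n: the total order on the edges {i,j} (i ≢ j) given
-- by an injective rank function on unordered pairs.
IsEdgeOrdering : (n : ℕ) → (Fin n → Fin n → ℕ) → Set
IsEdgeOrdering n r =
  (∀ i j → r i j ≡ r j i) ×
  (∀ i j k l → i ≢ j → k ≢ l → r i j ≡ r k l →
     (i ≡ k × j ≡ l) ⊎ (i ≡ l × j ≡ k))

-- Segments p a p b and p c p d cross (properly intersect).
Cross : {n : ℕ} → (Fin n → Point) → Fin n × Fin n → Fin n × Fin n → Set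
Cross p (a , b) (c , d) =
  (orient (p a) (p b) (p c) ℤ.* orient (p a) (p b) (p d)) ℤ.< 0ℤ ×
  (orient (p c) (p d) (p a) ℤ.* orient (p c) (p d) (p b)) ℤ.< 0ℤ

-- Edges of the path given by its vertex sequence.
pathEdges : {n : ℕ} → List (Fin n) → List (Fin n × Fin n)
pathEdges (a ∷ b ∷ rest) = (a , b) ∷ pathEdges (b ∷ rest)
pathEdges _ = []

-- No two edges of the path cross.
NonCrossing : {n : ℕ} → (Fin n → Point) → List (Fin n) → Set
NonCrossing p vs = ∀ e f → e ∈ pathEdges vs → f ∈ pathEdges vs → ¬ Cross p e f

-- Consecutive edge ranks strictly increase / strictly decrease.
Increasing : {n : ℕ} → (Fin n → Fin n → ℕ) → List (Fin n) → Set
Increasing r (a ∷ b ∷ c ∷ rest) = r a b ℕ.< r b c × Increasing r (b ∷ c ∷ rest)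
Increasing r _ = ⊤

Decreasing : {n : ℕ} → (Fin n → Fin n → ℕ) → List (Fin n) → Set
Decreasing r (a ∷ b ∷ c ∷ rest) = r b c ℕ.< r a b × Decreasing r (b ∷ c ∷ rest)
Decreasing r _ = ⊤

Monotone : {n : ℕ} → (Fin n → Fin n → ℕ) → List (Fin n) → Set
Monotone r vs = Increasing r vs ⊎ Decreasing r vs

-- Length (number of edges) of a path given by its vertex list.
pathLength : {n : ℕ} → List (Fin n) → ℕ
pathLength vs = Data.List.length vs ℕ.∸ 1

-- Kₙ has a straight-line drawing and an edge-ordering in which every
-- non-crossing monotone path has at most 4 ⌊log₂ n⌋ edges.
--
-- Vertex x < n is drawn at (x, x²) on the parabola, where two chords cross
-- exactly when their endpoints interleave.  The level of an edge {x,y} is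
-- the height of the lowest common ancestor of x and y in the dyadic tree
-- (least L with ⌊x/2^L⌋ = ⌊y/2^L⌋), so it lies in 1 … K = 1 + ⌊log₂ n⌋.
-- Edges are ranked lexicographically by (level, x + y, min(x,y)).
-- Key fact: if path edges ab, bc, cd share a level and have monotone
-- endpoint sums, then a, c sit in one child subtree and b, d in the other,
-- which forces ab and cd to interleave, i.e. cross.  So along a non-crossing
-- monotone path the level changes strictly every two edges, bounding its
-- length by 2K.
module Submission where

open import Defs
open import Data.Nat using (ℕ; zero; suc; _≤_; _<_; _*_; _+_; z≤n; s≤s; _^_; ⌊_/2⌋; _∸_; _⊓_)
open import Data.Nat.Properties
open import Data.Nat.Logarithm using (⌊log₂_⌋; ⌊log₂⌋-mono-≤; ⌊log₂[2^n]⌋≡n; ⌊log₂⌊n/2⌋⌋≡⌊log₂n⌋∸1)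
import Data.Nat.Tactic.RingSolver as ℕ-Solver
import Data.Integer as ℤ
import Data.Integer.Properties as ℤP
import Data.Integer.Tactic.RingSolver as ℤ-Solver
open import Data.Sign as Sign using (Sign)
open import Data.Fin using (Fin; toℕ)
open import Data.Fin.Properties using (toℕ-injective; toℕ<n)
open import Data.Product using (Σ; _×_; _,_; proj₁; proj₂)
open import Data.Sum using (_⊎_; inj₁; inj₂)
open import Data.Empty using (⊥-elim)
open import Data.List using (List; []; _∷_; length)
open import Data.List.Relation.Unary.Any using (here; there)
open import Data.List.Relation.Unary.All using (_∷_)
open import Data.List.Relation.Unary.AllPairs using (_∷_)
open import Data.List.Relation.Unary.Unique.Propositional using (Unique)
open import Relation.Binary using (Tri; tri<; tri≈; tri>)
open import Relation.Nullary using (¬_; yes; no)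
open import Relation.Binary.PropositionalEquality

open ℤ using (ℤ; +_; _◃_; 0ℤ)

-- Parabola geometry

-- The point of the parabola y = x² above x.
P : ℕ → Point
P x = (+ x , + (x * x))

-- The orientation of three parabola points factors as a Vandermonde product.
orient-parabola : ∀ a b c →
  orient (P a) (P b) (P c) ≡ ((+ b ℤ.- + a) ℤ.* (+ c ℤ.- + a)) ℤ.* (+ c ℤ.- + b)
orient-parabola a b c rewrite ℤP.pos-* a a | ℤP.pos-* b b | ℤP.pos-* c c =
  vandermonde (+ a) (+ b) (+ c)
  where
  vandermonde : ∀ A B C →
    (B ℤ.- A) ℤ.* (C ℤ.* C ℤ.- A ℤ.* A) ℤ.- (B ℤ.* B ℤ.- A ℤ.* A) ℤ.* (C ℤ.- A)
      ≡ ((B ℤ.- A) ℤ.* (C ℤ.- A)) ℤ.* (C ℤ.- B)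
  vandermonde = ℤ-Solver.solve-∀

-- `HasSign s i`: the integer i is non-zero with sign s.
data HasSign (s : Sign) (i : ℤ) : Set where
  signed : ∀ k → i ≡ s ◃ suc k → HasSign s i

-- Signs multiply.
sign-* : ∀ {s t i j} → HasSign s i → HasSign t j → HasSign (s Sign.* t) (i ℤ.* j)
sign-* {Sign.+} {Sign.+} (signed k refl) (signed l refl) = signed _ refl
sign-* {Sign.+} {Sign.-} (signed k refl) (signed l refl) = signed _ refl
sign-* {Sign.-} {Sign.+} (signed k refl) (signed l refl) = signed _ refl
sign-* {Sign.-} {Sign.-} (signed k refl) (signed l refl) = signed _ refl

-- A signed integer is non-zero; a negative one is below zero.
sign-≢0 : ∀ {s i} → HasSign s i → i ≢ 0ℤ
sign-≢0 {Sign.+} (signed k refl) ()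
sign-≢0 {Sign.-} (signed k refl) ()

sign-<0 : ∀ {i} → HasSign Sign.- i → i ℤ.< 0ℤ
sign-<0 (signed k refl) = ℤ.-<+

-- The sign of a difference j - i of naturals is the sign of their comparison.
diff-pos : ∀ {i j} → i < j → HasSign Sign.+ (+ j ℤ.- + i)
diff-pos {i} {j} i<j with j ∸ i in eq
... | zero = ⊥-elim (<⇒≢ (m<n⇒0<n∸m i<j) (sym eq))
... | suc k = signed k (trans (ℤP.m-n≡m⊖n j i) (trans (ℤP.⊖-≥ (<⇒≤ i<j)) (cong +_ eq)))

diff-neg : ∀ {i j} → j < i → HasSign Sign.- (+ j ℤ.- + i)
diff-neg {i} {j} j<i with i ∸ j in eq
... | zero = ⊥-elim (<⇒≢ (m<n⇒0<n∸m j<i) (sym eq))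
... | suc k = signed k (trans (ℤP.m-n≡m⊖n j i) (trans (ℤP.⊖-< j<i) (cong (λ t → ℤ.- (+ t)) eq)))

diff-signed : ∀ i j → i ≢ j → Σ Sign λ s → HasSign s (+ j ℤ.- + i)
diff-signed i j i≢j with <-cmp i j
... | tri< i<j _ _ = _ , diff-pos i<j
... | tri≈ _ i≡j _ = ⊥-elim (i≢j i≡j)
... | tri> _ _ j<i = _ , diff-neg j<i

-- The sign of an orientation is the product of the signs of the differences.
orient-sign : ∀ {s₁ s₂ s₃} a b c →
  HasSign s₁ (+ b ℤ.- + a) → HasSign s₂ (+ c ℤ.- + a) → HasSign s₃ (+ c ℤ.- + b) →
  HasSign ((s₁ Sign.* s₂) Sign.* s₃) (orient (P a) (P b) (P c))
orient-sign a b c ab ac bc rewrite orient-parabola a b c = sign-* (sign-* ab ac) bc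

-- Distinct parabola points are in general position.
parabola-general-position : ∀ a b c → a ≢ b → b ≢ c → a ≢ c → orient (P a) (P b) (P c) ≢ 0ℤ
parabola-general-position a b c a≢b b≢c a≢c = sign-≢0
  (orient-sign a b c (proj₂ (diff-signed a b a≢b)) (proj₂ (diff-signed a c a≢c))
                     (proj₂ (diff-signed b c b≢c)))

-- Crossing of the segments P a P b and P c P d.
CrossP : ℕ → ℕ → ℕ → ℕ → Set
CrossP a b c d =
  (orient (P a) (P b) (P c) ℤ.* orient (P a) (P b) (P d)) ℤ.< 0ℤ ×
  (orient (P c) (P d) (P a) ℤ.* orient (P c) (P d) (P b)) ℤ.< 0ℤ

-- For x < y < z < w the chords {x,z} and {y,w} of the parabola cross,
-- whichever way their endpoints are listed.
module _ {x y z w : ℕ} (x<y : x < y) (y<z : y < z) (z<w : z < w) where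
  private
    x<z : x < z
    x<z = <-trans x<y y<z
    y<w : y < w
    y<w = <-trans y<z z<w
    x<w : x < w
    x<w = <-trans x<z z<w
    -- The signs of the eight orientations involved.
    xz-y : HasSign Sign.- (orient (P x) (P z) (P y))
    xz-y = orient-sign x z y (diff-pos x<z) (diff-pos x<y) (diff-neg y<z)
    xz-w : HasSign Sign.+ (orient (P x) (P z) (P w))
    xz-w = orient-sign x z w (diff-pos x<z) (diff-pos x<w) (diff-pos z<w)
    zx-w : HasSign Sign.- (orient (P z) (P x) (P w))
    zx-w = orient-sign z x w (diff-neg x<z) (diff-pos z<w) (diff-pos x<w)
    zx-y : HasSign Sign.+ (orient (P z) (P x) (P y))
    zx-y = orient-sign z x y (diff-neg x<z) (diff-neg y<z) (diff-pos x<y)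
    yw-x : HasSign Sign.+ (orient (P y) (P w) (P x))
    yw-x = orient-sign y w x (diff-pos y<w) (diff-neg x<y) (diff-neg x<w)
    yw-z : HasSign Sign.- (orient (P y) (P w) (P z))
    yw-z = orient-sign y w z (diff-pos y<w) (diff-pos y<z) (diff-neg z<w)
    wy-z : HasSign Sign.+ (orient (P w) (P y) (P z))
    wy-z = orient-sign w y z (diff-neg y<w) (diff-neg z<w) (diff-pos y<z)
    wy-x : HasSign Sign.- (orient (P w) (P y) (P x))
    wy-x = orient-sign w y x (diff-neg y<w) (diff-neg x<w) (diff-neg x<y)

  cross-xz-yw : CrossP x z y w
  cross-xz-yw = sign-<0 (sign-* xz-y xz-w) , sign-<0 (sign-* yw-x yw-z)

  cross-zx-wy : CrossP z x w y
  cross-zx-wy = sign-<0 (sign-* zx-w zx-y) , sign-<0 (sign-* wy-z wy-x)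

  cross-yw-xz : CrossP y w x z
  cross-yw-xz = sign-<0 (sign-* yw-x yw-z) , sign-<0 (sign-* xz-y xz-w)

  cross-wy-zx : CrossP w y z x
  cross-wy-zx = sign-<0 (sign-* wy-z wy-x) , sign-<0 (sign-* zx-w zx-y)

-- The dyadic tree on ℕ: the parent of x is ⌊x/2⌋

half : ℕ → ℕ
half = ⌊_/2⌋

-- Every number is the even or the odd child of its parent.
even-or-odd : ∀ n → n ≡ half n + half n ⊎ n ≡ suc (half n + half n)
even-or-odd zero = inj₁ refl
even-or-odd (suc zero) = inj₂ refl
even-or-odd (suc (suc n)) with even-or-odd n
... | inj₁ e = inj₁ (cong suc (trans (cong suc e) (sym (+-suc (half n) (half n)))))
... | inj₂ e = inj₂ (cong suc (trans (cong suc e) (cong suc (sym (+-suc (half n) (half n))))))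

-- The parent of n is ⌊n/2⌋: 2·⌊n/2⌋ ≤ n ≤ 2·⌊n/2⌋ + 1.
half-lower : ∀ n → half n + half n ≤ n
half-lower n with even-or-odd n
... | inj₁ e = ≤-reflexive (sym e)
... | inj₂ e = subst (half n + half n ≤_) (sym e) (n≤1+n _)

half-upper : ∀ n → n ≤ suc (half n + half n)
half-upper n with even-or-odd n
... | inj₁ e = subst (_≤ suc (half n + half n)) (sym e) (n≤1+n _)
... | inj₂ e = ≤-reflexive e

-- Halving moves a leaf below 2^(k+1) to a node below 2^k.
half-< : ∀ k n → n < 2 ^ suc k → half n < 2 ^ k
half-< k n n<2^k+1 = ≰⇒> λ 2^k≤half → <⇒≱ n<2^k+1 (begin
  2 ^ suc k        ≡⟨ cong (_+_ (2 ^ k)) (+-identityʳ (2 ^ k)) ⟩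
  2 ^ k + 2 ^ k    ≤⟨ +-mono-≤ 2^k≤half 2^k≤half ⟩
  half n + half n  ≤⟨ half-lower n ⟩
  n                ∎)
  where open ≤-Reasoning

-- A node has only two children: two children of a common parent that both
-- differ from a third child v coincide.
siblings : ∀ u v w → half u ≡ half v → half w ≡ half v → u ≢ v → w ≢ v → u ≡ w
siblings u v w hu hw u≢v w≢v with even-or-odd u | even-or-odd v | even-or-odd w
... | inj₁ a | inj₁ b | _ = ⊥-elim (u≢v (trans a (trans (cong (λ t → t + t) hu) (sym b))))
... | inj₂ a | inj₂ b | _ = ⊥-elim (u≢v (trans a (trans (cong (λ t → suc (t + t)) hu) (sym b))))
... | _ | inj₁ b | inj₁ c = ⊥-elim (w≢v (trans c (trans (cong (λ t → t + t) hw) (sym b))))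
... | _ | inj₂ b | inj₂ c = ⊥-elim (w≢v (trans c (trans (cong (λ t → suc (t + t)) hw) (sym b))))
... | inj₂ a | inj₁ _ | inj₂ c = trans a (trans (cong (λ t → suc (t + t)) (trans hu (sym hw))) (sym c))
... | inj₁ a | inj₂ _ | inj₁ c = trans a (trans (cong (λ t → t + t) (trans hu (sym hw))) (sym c))

-- `ancestor L x` = ⌊x / 2^L⌋, the ancestor of x at height L.
ancestor : ℕ → ℕ → ℕ
ancestor zero x = x
ancestor (suc L) x = ancestor L (half x)

-- The ancestor at height L + 1 is the parent of the ancestor at height L,
-- and ancestors are monotone in the leaf.
ancestor-suc : ∀ L x → ancestor (suc L) x ≡ half (ancestor L x)
ancestor-suc zero x = refl
ancestor-suc (suc L) x = ancestor-suc L (half x)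

ancestor-mono : ∀ L {x y} → x ≤ y → ancestor L x ≤ ancestor L y
ancestor-mono zero x≤y = x≤y
ancestor-mono (suc L) x≤y = ancestor-mono L (⌊n/2⌋-mono x≤y)

-- Ancestors preserve the order of leaves whose ancestors differ.
ancestor-reflects-< : ∀ L {x y} → ancestor L x < ancestor L y → x < y
ancestor-reflects-< L lt = ≰⇒> λ y≤x → <⇒≱ lt (ancestor-mono L y≤x)

-- `level k a b`: height of the lowest common ancestor of a and b, searching
-- up to height k.
level : ℕ → ℕ → ℕ → ℕ
level zero a b = 0
level (suc k) a b with a ≟ b
... | yes _ = 0
... | no _ = suc (level k (half a) (half b))

-- Basic facts about levels: bounded by the search height, symmetric, and
-- computed by one halving step for distinct leaves.
level-≤ : ∀ k a b → level k a b ≤ k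
level-≤ zero a b = z≤n
level-≤ (suc k) a b with a ≟ b
... | yes _ = z≤n
... | no _ = s≤s (level-≤ k (half a) (half b))

level-sym : ∀ k a b → level k a b ≡ level k b a
level-sym zero a b = refl
level-sym (suc k) a b with a ≟ b | b ≟ a
... | yes _ | yes _ = refl
... | yes a≡b | no b≢a = ⊥-elim (b≢a (sym a≡b))
... | no a≢b | yes b≡a = ⊥-elim (a≢b (sym b≡a))
... | no _ | no _ = cong suc (level-sym k (half a) (half b))

level-suc : ∀ k a b → a ≢ b → level (suc k) a b ≡ suc (level k (half a) (half b))
level-suc k a b a≢b with a ≟ b
... | yes a≡b = ⊥-elim (a≢b a≡b)
... | no _ = refl

-- Level 0 means equality, for leaves below 2^k.
level-zero : ∀ k x y → x < 2 ^ k → y < 2 ^ k → level k x y ≡ 0 → x ≡ y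
level-zero zero x y (s≤s z≤n) (s≤s z≤n) _ = refl
level-zero (suc k) x y _ _ e with x ≟ y
... | yes x≡y = x≡y
level-zero (suc k) x y _ _ () | no _

-- For leaves below 2^k the search does not run out: level k x y = L + 1
-- means that x, y have a common ancestor at height L + 1 but not at L.
level-spec : ∀ k L x y → x < 2 ^ k → y < 2 ^ k → level k x y ≡ suc L →
  ancestor (suc L) x ≡ ancestor (suc L) y × ancestor L x ≢ ancestor L y
level-spec zero L x y _ _ ()
level-spec (suc k) L x y x< y< e with x ≟ y
level-spec (suc k) L x y x< y< () | yes _
level-spec (suc k) zero x y x< y< e | no x≢y =
  level-zero k (half x) (half y) (half-< k x x<) (half-< k y y<) (suc-injective e) , x≢y
level-spec (suc k) (suc L) x y x< y< e | no _ =
  level-spec k L (half x) (half y) (half-< k x x<) (half-< k y y<) (suc-injective e)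

-- The key crossing lemma

-- Along a path a b c d whose three edges have the same level L + 1, the
-- height-L ancestors alternate between two distinct siblings.
same-level-alternates : ∀ k L a b c d → a < 2 ^ k → b < 2 ^ k → c < 2 ^ k → d < 2 ^ k →
  level k a b ≡ suc L → level k b c ≡ suc L → level k c d ≡ suc L →
  ancestor L a ≡ ancestor L c × ancestor L b ≡ ancestor L d × ancestor L a ≢ ancestor L b
same-level-alternates k L a b c d a< b< c< d< eab ebc ecd =
  siblings (up a) (up b) (up c) (parent a b (proj₁ ab)) (sym (parent b c (proj₁ bc)))
           (proj₂ ab) (λ e → proj₂ bc (sym e)) ,
  siblings (up b) (up c) (up d) (parent b c (proj₁ bc)) (sym (parent c d (proj₁ cd)))
           (proj₂ bc) (λ e → proj₂ cd (sym e)) ,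
  proj₂ ab
  where
  up : ℕ → ℕ
  up = ancestor L
  Step : ℕ → ℕ → Set
  Step x y = ancestor (suc L) x ≡ ancestor (suc L) y × up x ≢ up y
  ab : Step a b
  ab = level-spec k L a b a< b< eab
  bc : Step b c
  bc = level-spec k L b c b< c< ebc
  cd : Step c d
  cd = level-spec k L c d c< d< ecd
  parent : ∀ x y → ancestor (suc L) x ≡ ancestor (suc L) y → half (up x) ≡ half (up y)
  parent x y e = trans (sym (ancestor-suc L x)) (trans e (ancestor-suc L y))

-- Three consecutive edges of one level with monotone endpoint sums force
-- the first and the last edge to cross.
same-level-crosses : ∀ k L a b c d → a < 2 ^ k → b < 2 ^ k → c < 2 ^ k → d < 2 ^ k →
  level k a b ≡ suc L → level k b c ≡ suc L → level k c d ≡ suc L →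
  (a < c × b < d) ⊎ (c < a × d < b) → CrossP a b c d
same-level-crosses k L a b c d a< b< c< d< eab ebc ecd order =
  by-cases (<-cmp (up a) (up b)) order
  where
  up : ℕ → ℕ
  up = ancestor L
  alt : up a ≡ up c × up b ≡ up d × up a ≢ up b
  alt = same-level-alternates k L a b c d a< b< c< d< eab ebc ecd
  a~c : up a ≡ up c
  a~c = proj₁ alt
  b~d : up b ≡ up d
  b~d = proj₁ (proj₂ alt)
  a≁b : up a ≢ up b
  a≁b = proj₂ (proj₂ alt)
  lift : ∀ {x y} → up x < up y → x < y
  lift = ancestor-reflects-< L
  by-cases : Tri (up a < up b) (up a ≡ up b) (up b < up a) → (a < c × b < d) ⊎ (c < a × d < b) → CrossP a b c d
  by-cases (tri≈ _ e _) _ = ⊥-elim (a≁b e)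
  by-cases (tri< a<b _ _) (inj₁ (a<c , b<d)) = cross-xz-yw a<c (lift (subst (_< up b) a~c a<b)) b<d
  by-cases (tri> _ _ b<a) (inj₁ (a<c , b<d)) = cross-zx-wy b<d (lift (subst (_< up a) b~d b<a)) a<c
  by-cases (tri< a<b _ _) (inj₂ (c<a , d<b)) = cross-yw-xz c<a (lift (subst (up a <_) b~d a<b)) d<b
  by-cases (tri> _ _ b<a) (inj₂ (c<a , d<b)) = cross-wy-zx d<b (lift (subst (up b <_) a~c b<a)) c<a

-- Logarithm bounds

log₂≥1 : ∀ {n} → 2 ≤ n → 1 ≤ ⌊log₂ n ⌋
log₂≥1 {n} 2≤n = subst (_≤ ⌊log₂ n ⌋) (⌊log₂[2^n]⌋≡n 1) (⌊log₂⌋-mono-≤ 2≤n)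

-- n < 2^(k+1) as soon as ⌊log₂ n⌋ ≤ k.
below-power : ∀ k n → ⌊log₂ n ⌋ ≤ k → n < 2 ^ suc k
below-power zero n log≤0 = ≰⇒> λ 2≤n → <-irrefl refl (≤-trans (log₂≥1 2≤n) log≤0)
below-power (suc k) n log≤k+1 = begin-strict
  n                        ≤⟨ half-upper n ⟩
  suc (half n + half n)    <⟨ s≤s (+-monoʳ-< (half n) (n<1+n (half n))) ⟩
  suc (half n) + suc (half n) ≤⟨ +-mono-≤ half< half< ⟩
  2 ^ suc k + 2 ^ suc k    ≡⟨ cong (_+_ (2 ^ suc k)) (sym (+-identityʳ (2 ^ suc k))) ⟩
  2 ^ suc (suc k)          ∎
  where
  open ≤-Reasoning
  half< : half n < 2 ^ suc k
  half< = below-power k (half n)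
    (subst (_≤ k) (sym (⌊log₂⌊n/2⌋⌋≡⌊log₂n⌋∸1 n)) (∸-monoˡ-≤ 1 log≤k+1))

-- Lexicographic encoding: x * M + s with s < M encodes the pair (x , s)

-- Comparing encodings compares the pairs lexicographically.
lex-≤ : ∀ M x y s t → t < M → x * M + s ≤ y * M + t → x < y ⊎ (x ≡ y × s ≤ t)
lex-≤ M x y s t t<M le with <-cmp x y
... | tri< x<y _ _ = inj₁ x<y
... | tri≈ _ refl _ = inj₂ (refl , +-cancelˡ-≤ (x * M) s t le)
... | tri> _ _ y<x = ⊥-elim (<⇒≱ (begin-strict
  y * M + t   <⟨ +-monoʳ-< (y * M) t<M ⟩
  y * M + M   ≡⟨ +-comm (y * M) M ⟩
  suc y * M   ≤⟨ *-monoˡ-≤ M y<x ⟩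
  x * M       ≤⟨ m≤m+n (x * M) s ⟩
  x * M + s   ∎) le)
  where open ≤-Reasoning

lex-< : ∀ M x y s t → t < M → x * M + s < y * M + t → x < y ⊎ (x ≡ y × s < t)
lex-< M x y s t t<M lt = lex-≤ M x y (suc s) t t<M (subst (_≤ y * M + t) (sym (+-suc (x * M) s)) lt)

-- The encoding is injective.
lex-≡ : ∀ M x y s t → s < M → t < M → x * M + s ≡ y * M + t → x ≡ y × s ≡ t
lex-≡ M x y s t s<M t<M e
  with lex-≤ M x y s t t<M (≤-reflexive e) | lex-≤ M y x t s s<M (≤-reflexive (sym e))
... | inj₁ x<y | inj₁ y<x = ⊥-elim (<-asym x<y y<x)
... | inj₁ x<y | inj₂ (y≡x , _) = ⊥-elim (<-irrefl (sym y≡x) x<y)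
... | inj₂ (x≡y , _) | inj₁ y<x = ⊥-elim (<-irrefl (sym x≡y) y<x)
... | inj₂ (x≡y , s≤t) | inj₂ (_ , t≤s) = x≡y , ≤-antisym s≤t t≤s

-- An unordered pair is determined by its sum and its minimum.
pair-determined : ∀ {x y z w} → x + y ≡ z + w → x ⊓ y ≡ z ⊓ w →
  (x ≡ z × y ≡ w) ⊎ (x ≡ w × y ≡ z)
pair-determined {x} {y} {z} {w} sum min with ⊓-sel x y | ⊓-sel z w
... | inj₁ p | inj₁ q = let x≡z = trans (sym p) (trans min q) in
  inj₁ (x≡z , +-cancelˡ-≡ x y w (trans sum (cong (_+ w) (sym x≡z))))
... | inj₁ p | inj₂ q = let x≡w = trans (sym p) (trans min q) in
  inj₂ (x≡w , +-cancelˡ-≡ x y z (trans sum (trans (+-comm z w) (cong (_+ z) (sym x≡w)))))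
... | inj₂ p | inj₁ q = let y≡z = trans (sym p) (trans min q) in
  inj₂ (+-cancelʳ-≡ y x w (trans sum (trans (+-comm z w) (cong (_+_ w) (sym y≡z)))) , y≡z)
... | inj₂ p | inj₂ q = let y≡w = trans (sym p) (trans min q) in
  inj₁ (+-cancelʳ-≡ y x z (trans sum (cong (_+_ z) (sym y≡w))) , y≡w)

-- The drawing and the edge-ordering of Kₙ

module Construction (n : ℕ) where

  -- Edge levels range over 1 … K.
  K : ℕ
  K = suc ⌊log₂ n ⌋

  vertex-bound : (i : Fin n) → toℕ i < 2 ^ K
  vertex-bound i = <-trans (toℕ<n i) (below-power ⌊log₂ n ⌋ n ≤-refl)

  point : Fin n → Point
  point i = P (toℕ i)

  lvl : Fin n → Fin n → ℕ
  lvl a b = level K (toℕ a) (toℕ b)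

  -- Secondary key: endpoint sum, ties broken by the smaller endpoint.
  key : ℕ → ℕ → ℕ
  key x y = (x + y) * n + x ⊓ y

  M : ℕ
  M = (n + n) * n

  key-< : ∀ x y → x < n → y < n → key x y < M
  key-< x y x<n y<n = begin-strict
    (x + y) * n + x ⊓ y  <⟨ +-monoʳ-< ((x + y) * n) (≤-<-trans (m⊓n≤m x y) x<n) ⟩
    (x + y) * n + n      ≡⟨ +-comm ((x + y) * n) n ⟩
    suc (x + y) * n      ≤⟨ *-monoˡ-≤ n (+-mono-≤ x<n (<⇒≤ y<n)) ⟩
    (n + n) * n          ∎
    where open ≤-Reasoning

  -- The rank of edge {a,b}: lexicographic in (level, key).
  rank : Fin n → Fin n → ℕ
  rank a b = lvl a b * M + key (toℕ a) (toℕ b)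

  rank-sym : ∀ a b → rank a b ≡ rank b a
  rank-sym a b rewrite level-sym K (toℕ a) (toℕ b) | +-comm (toℕ a) (toℕ b)
                     | ⊓-comm (toℕ a) (toℕ b) = refl

  rank-injective : ∀ i j k l → rank i j ≡ rank k l → (i ≡ k × j ≡ l) ⊎ (i ≡ l × j ≡ k)
  rank-injective i j k l e with pair-determined (proj₁ same-key) (proj₂ same-key)
    where
    same-level-key : lvl i j ≡ lvl k l × key (toℕ i) (toℕ j) ≡ key (toℕ k) (toℕ l)
    same-level-key = lex-≡ M (lvl i j) (lvl k l) (key (toℕ i) (toℕ j)) (key (toℕ k) (toℕ l))
                       (key-< _ _ (toℕ<n i) (toℕ<n j)) (key-< _ _ (toℕ<n k) (toℕ<n l)) e
    same-key : toℕ i + toℕ j ≡ toℕ k + toℕ l × toℕ i ⊓ toℕ j ≡ toℕ k ⊓ toℕ l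
    same-key = lex-≡ n (toℕ i + toℕ j) (toℕ k + toℕ l) (toℕ i ⊓ toℕ j) (toℕ k ⊓ toℕ l)
                 (≤-<-trans (m⊓n≤m _ _) (toℕ<n i)) (≤-<-trans (m⊓n≤m _ _) (toℕ<n k))
                 (proj₂ same-level-key)
  ... | inj₁ (i≡k , j≡l) = inj₁ (toℕ-injective i≡k , toℕ-injective j≡l)
  ... | inj₂ (i≡l , j≡k) = inj₂ (toℕ-injective i≡l , toℕ-injective j≡k)

  -- Comparing ranks compares levels first, then keys.
  rank-< : ∀ a b c d → rank a b < rank c d →
    lvl a b < lvl c d ⊎ (lvl a b ≡ lvl c d × key (toℕ a) (toℕ b) < key (toℕ c) (toℕ d))
  rank-< a b c d = lex-< M (lvl a b) (lvl c d) (key (toℕ a) (toℕ b)) (key (toℕ c) (toℕ d))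
                           (key-< _ _ (toℕ<n c) (toℕ<n d))

  -- On a path a b c, comparing keys of ab and bc compares a with c.
  key-<⇒< : ∀ (a b c : Fin n) → toℕ a ≢ toℕ c →
    key (toℕ a) (toℕ b) < key (toℕ b) (toℕ c) → toℕ a < toℕ c
  key-<⇒< a b c a≢c lt = ≤∧≢⇒< (+-cancelʳ-≤ (toℕ b) (toℕ a) (toℕ c) sums) a≢c
    where
    sums : toℕ a + toℕ b ≤ toℕ c + toℕ b
    sums with lex-< n (toℕ a + toℕ b) (toℕ b + toℕ c) _ _ (≤-<-trans (m⊓n≤m _ _) (toℕ<n b)) lt
    ... | inj₁ s< = subst (toℕ a + toℕ b ≤_) (+-comm (toℕ b) (toℕ c)) (<⇒≤ s<)
    ... | inj₂ (s≡ , _) = ≤-reflexive (trans s≡ (+-comm (toℕ b) (toℕ c)))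

  -- Monotone paths

  toℕ-≢ : {i j : Fin n} → i ≢ j → toℕ i ≢ toℕ j
  toℕ-≢ i≢j e = i≢j (toℕ-injective e)

  -- Edges join distinct vertices, so their level is at least 1.
  level-positive : (a b : Fin n) → toℕ a ≢ toℕ b → 1 ≤ lvl a b
  level-positive a b a≢b rewrite level-suc ⌊log₂ n ⌋ (toℕ a) (toℕ b) a≢b = s≤s z≤n

  -- The distinctness facts about the first four vertices a b c d of a path
  -- that the two-step lemmas use.
  record Distinct4 (a b c d : Fin n) : Set where
    field
      a≢b : toℕ a ≢ toℕ b
      a≢c : toℕ a ≢ toℕ c
      b≢d : toℕ b ≢ toℕ d

  distinct4 : ∀ {a b c d rest} → Unique (a ∷ b ∷ c ∷ d ∷ rest) → Distinct4 a b c d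
  distinct4 ((ab ∷ ac ∷ _) ∷ (_ ∷ bd ∷ _) ∷ _) = record
    { a≢b = toℕ-≢ ab ; a≢c = toℕ-≢ ac ; b≢d = toℕ-≢ bd }

  -- Consecutive edges ab, bc, cd of equal level whose endpoints are ordered
  -- as for increasing (or decreasing) endpoint sums make ab and cd cross.
  equal-levels-cross : ∀ a b c d → Distinct4 a b c d → lvl a b ≡ lvl b c → lvl b c ≡ lvl c d →
    (toℕ a < toℕ c × toℕ b < toℕ d) ⊎ (toℕ c < toℕ a × toℕ d < toℕ b) →
    Cross point (a , b) (c , d)
  equal-levels-cross a b c d dist e₁ e₂ =
    same-level-crosses K L _ _ _ _ (vertex-bound a) (vertex-bound b) (vertex-bound c) (vertex-bound d)
      eab (trans (sym e₁) eab) (trans (sym e₂) (trans (sym e₁) eab))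
    where
    L = level ⌊log₂ n ⌋ (half (toℕ a)) (half (toℕ b))
    eab : lvl a b ≡ suc L
    eab = level-suc ⌊log₂ n ⌋ (toℕ a) (toℕ b) (Distinct4.a≢b dist)

  -- Along a non-crossing increasing path the level grows every two edges.
  increasing-two-step : ∀ a b c d → Distinct4 a b c d → ¬ Cross point (a , b) (c , d) →
    rank a b < rank b c → rank b c < rank c d → lvl a b < lvl c d
  increasing-two-step a b c d dist no-cross ab<bc bc<cd with rank-< a b b c ab<bc | rank-< b c c d bc<cd
  ... | inj₁ l₁ | inj₁ l₂ = <-trans l₁ l₂
  ... | inj₁ l₁ | inj₂ (e₂ , _) = <-≤-trans l₁ (≤-reflexive e₂)
  ... | inj₂ (e₁ , _) | inj₁ l₂ = subst (_< lvl c d) (sym e₁) l₂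
  ... | inj₂ (e₁ , k₁) | inj₂ (e₂ , k₂) = ⊥-elim (no-cross (equal-levels-cross a b c d dist e₁ e₂
        (inj₁ (key-<⇒< a b c (Distinct4.a≢c dist) k₁ , key-<⇒< b c d (Distinct4.b≢d dist) k₂))))

  -- Along a non-crossing decreasing path the level drops every two edges.
  decreasing-two-step : ∀ a b c d → Distinct4 a b c d → ¬ Cross point (a , b) (c , d) →
    rank b c < rank a b → rank c d < rank b c → lvl c d < lvl a b
  decreasing-two-step a b c d dist no-cross bc<ab cd<bc with rank-< b c a b bc<ab | rank-< c d b c cd<bc
  ... | inj₁ l₁ | inj₁ l₂ = <-trans l₂ l₁
  ... | inj₂ (e₁ , _) | inj₁ l₂ = <-≤-trans l₂ (≤-reflexive e₁)
  ... | inj₁ l₁ | inj₂ (e₂ , _) = subst (_< lvl a b) (sym e₂) l₁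
  ... | inj₂ (e₁ , k₁) | inj₂ (e₂ , k₂) = ⊥-elim (no-cross (equal-levels-cross a b c d dist (sym e₁) (sym e₂)
        (inj₂ ( key-<⇒< c b a (λ e → Distinct4.a≢c dist (sym e)) (reorder c b a k₁)
              , key-<⇒< d c b (λ e → Distinct4.b≢d dist (sym e)) (reorder d c b k₂)))))
    where
    -- The key is symmetric, so a decreasing step read backwards is increasing.
    key-sym : ∀ x y → key x y ≡ key y x
    key-sym x y rewrite +-comm x y | ⊓-comm x y = refl
    reorder : ∀ (x y z : Fin n) → key (toℕ y) (toℕ x) < key (toℕ z) (toℕ y) →
              key (toℕ x) (toℕ y) < key (toℕ y) (toℕ z)
    reorder x y z lt = subst₂ _<_ (key-sym (toℕ y) (toℕ x)) (key-sym (toℕ z) (toℕ y)) lt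

  tail-non-crossing : ∀ {a : Fin n} {vs} → NonCrossing point (a ∷ vs) → NonCrossing point vs
  tail-non-crossing {vs = []} nc e f ()
  tail-non-crossing {vs = _ ∷ _} nc e f e∈ f∈ = nc e f (there e∈) (there f∈)

  tail-unique : ∀ {a : Fin n} {vs} → Unique (a ∷ vs) → Unique vs
  tail-unique (_ ∷ u) = u

  first-last-no-cross : ∀ {a b c d rest} → NonCrossing point (a ∷ b ∷ c ∷ d ∷ rest) →
    ¬ Cross point (a , b) (c , d)
  first-last-no-cross nc = nc _ _ (here refl) (there (there (here refl)))

  -- Levels are at most K, so 2 + 2 · level ab ≤ 2(K + 1).
  edge-cost : (a b : Fin n) → 2 + 2 * lvl a b ≤ 2 * suc K
  edge-cost a b =
    subst (_≤ 2 * suc K) (*-suc 2 (lvl a b)) (*-monoʳ-≤ 2 (s≤s (level-≤ K (toℕ a) (toℕ b))))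

  -- An increasing path starting with edge ab has at most 2(K + 1 - level ab) edges.
  increasing-bound : ∀ a b vs → Unique (a ∷ b ∷ vs) → NonCrossing point (a ∷ b ∷ vs) →
    Increasing rank (a ∷ b ∷ vs) → suc (length vs) + 2 * lvl a b ≤ 2 * suc K
  increasing-bound a b [] _ _ _ = ≤-trans (n≤1+n _) (edge-cost a b)
  increasing-bound a b (c ∷ []) _ _ _ = edge-cost a b
  increasing-bound a b (c ∷ d ∷ rest) u nc (ab<bc , bc<cd , inc) = begin
    3 + length rest + 2 * lvl a b    ≡⟨ two-more-edges (length rest) (lvl a b) ⟩
    1 + length rest + 2 * suc (lvl a b) ≤⟨ +-monoʳ-≤ (1 + length rest) (*-monoʳ-≤ 2 step) ⟩
    1 + length rest + 2 * lvl c d    ≤⟨ increasing-bound c d rest (tail-unique (tail-unique u))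
                                          (tail-non-crossing (tail-non-crossing nc)) inc ⟩
    2 * suc K                        ∎
    where
    open ≤-Reasoning
    step : lvl a b < lvl c d
    step = increasing-two-step a b c d (distinct4 u) (first-last-no-cross nc) ab<bc bc<cd
    two-more-edges : ∀ l x → 3 + l + 2 * x ≡ 1 + l + 2 * suc x
    two-more-edges = ℕ-Solver.solve-∀

  -- A decreasing path starting with edge ab has at most 2 · level ab edges.
  decreasing-bound : ∀ a b vs → Unique (a ∷ b ∷ vs) → NonCrossing point (a ∷ b ∷ vs) →
    Decreasing rank (a ∷ b ∷ vs) → suc (length vs) ≤ 2 * lvl a b
  decreasing-bound a b [] ((a≢b ∷ _) ∷ _) _ _ =
    ≤-trans (s≤s z≤n) (*-monoʳ-≤ 2 (level-positive a b (toℕ-≢ a≢b)))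
  decreasing-bound a b (c ∷ []) ((a≢b ∷ _) ∷ _) _ _ =
    *-monoʳ-≤ 2 (level-positive a b (toℕ-≢ a≢b))
  decreasing-bound a b (c ∷ d ∷ rest) u nc (bc<ab , cd<bc , dec) = begin
    3 + length rest          ≤⟨ +-monoʳ-≤ 2 (decreasing-bound c d rest (tail-unique (tail-unique u))
                                  (tail-non-crossing (tail-non-crossing nc)) dec) ⟩
    2 + 2 * lvl c d          ≡⟨ sym (*-suc 2 (lvl c d)) ⟩
    2 * suc (lvl c d)        ≤⟨ *-monoʳ-≤ 2 (decreasing-two-step a b c d (distinct4 u)
                                               (first-last-no-cross nc) bc<ab cd<bc) ⟩
    2 * lvl a b              ∎
    where open ≤-Reasoning

  -- Every non-crossing monotone path has at most 2K edges.
  monotone-bound : (vs : List (Fin n)) → Unique vs → NonCrossing point vs → Monotone rank vs →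
    pathLength vs ≤ 2 * K
  monotone-bound [] _ _ _ = z≤n
  monotone-bound (a ∷ []) _ _ _ = z≤n
  monotone-bound (a ∷ b ∷ rest) u@((a≢b ∷ _) ∷ _) nc (inj₁ inc) =
    +-cancelʳ-≤ 2 (suc (length rest)) (2 * K) (begin
      suc (length rest) + 2               ≤⟨ +-monoʳ-≤ (suc (length rest))
                                               (*-monoʳ-≤ 2 (level-positive a b (toℕ-≢ a≢b))) ⟩
      suc (length rest) + 2 * lvl a b     ≤⟨ increasing-bound a b rest u nc inc ⟩
      2 * suc K                           ≡⟨ trans (*-suc 2 K) (+-comm 2 (2 * K)) ⟩
      2 * K + 2                           ∎)
    where open ≤-Reasoning
  monotone-bound (a ∷ b ∷ rest) u nc (inj₂ dec) =
    ≤-trans (decreasing-bound a b rest u nc dec) (*-monoʳ-≤ 2 (level-≤ K (toℕ a) (toℕ b)))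

  drawing : IsDrawing n point
  drawing = (λ i j e → toℕ-injective (ℤP.+-injective (cong proj₁ e)))
          , (λ i j k i≢j j≢k i≢k → parabola-general-position (toℕ i) (toℕ j) (toℕ k)
               (toℕ-≢ i≢j) (toℕ-≢ j≢k) (toℕ-≢ i≢k))

  edge-ordering : IsEdgeOrdering n rank
  edge-ordering = rank-sym , λ i j k l _ _ → rank-injective i j k l

-- 2K = 2 + 2 ⌊log₂ n⌋ ≤ 4 ⌊log₂ n⌋ once ⌊log₂ n⌋ ≥ 1.
twice-suc≤4* : ∀ g → 1 ≤ g → 2 * suc g ≤ 4 * g
twice-suc≤4* (suc h) _ = subst (2 * suc (suc h) ≤_) (sym (split h)) (m≤m+n _ _)
  where
  split : ∀ h → 4 * suc h ≡ 2 * suc (suc h) + 2 * h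
  split = ℕ-Solver.solve-∀

theorem2 : Σ ℕ λ C → (n : ℕ) → 2 ≤ n →
    Σ (Fin n → Point) λ p → IsDrawing n p ×
    Σ (Fin n → Fin n → ℕ) λ r → IsEdgeOrdering n r ×
    ((vs : List (Fin n)) → Unique vs → NonCrossing p vs → Monotone r vs →
    pathLength vs ≤ C * ⌊log₂ n ⌋)
theorem2 = 4 , λ n 2≤n → let open Construction n in
  point , drawing , rank , edge-ordering ,
  λ vs u nc mono → ≤-trans (monotone-bound vs u nc mono) (twice-suc≤4* ⌊log₂ n ⌋ (log₂≥1 2≤n))
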